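{- Let $G$ and $H$ be nontrivial connected graphs with $\gamma_t(H)=2$. Then $\gamma_t(G)=\gamma_t(G\Box H)$ if and only if one of the following holds: (i) $G$ is isomorphic to $K_2$ and $\gamma(H)=1$; (ii) $H$ is isomorphic to $K_2$ and $G\in\mathcal{F}_1\cup\mathcal{F}_2\cup\mathcal{F}_3$.
   Context: All graphs are finite, simple, undirected. $\gamma(G)$ is the domination number and $\gamma_t(G)$ the total domination number (minimum size of a set $S$ with $N_G(S)=V(G)$, $N_G(S)$ the union of open neighborhoods of vertices of $S$). $G\Box H$ is the Cartesian product: vertex set $V(G)\times V(H)$, with $(u_1,v_1)\sim(u_2,v_2)$ iff either $u_1=u_2$ and $v_1v_2\in E(H)$, or $v_1=v_2$ and $u_1u_2\in E(G)$. $G[X]$ denotes the induced subgraph. The families are: $\mathcal{F}_1$ = graphs $G$ with $\gamma_t(G)=2\gamma(G)$; $\mathcal{F}_2$ = graphs $G$ having a minimum total dominating set $D$ that can be partitioned into two nonempty subsets $D_1,D_2$ with $D_1=V(G)\setminus N_G(D_2)$ and $D_2=V(G)\setminus N_G(D_1)$; $\mathcal{F}_3$ = graphs $G$ whose vertex set can be partitioned into two nonempty subsets $V_1,V_2$ with $G[V_1]\in\mathcal{F}_1$, $G[V_2]\in\mathcal{F}_2$, and $\gamma_t(G)=\gamma_t(G[V_1])+\gamma_t(G[V_2])$. -}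

module Defs where

open import Data.Bool.Base using (true; false)
open import Data.Fin.Base using (Fin; zero; suc; remQuot)
open import Data.Fin.Properties using (_≟_; any?)
open import Data.Fin.Subset using (Subset; _∈_; Nonempty; ⊤; ⊥; ∁; _∩_; _∪_; ∣_∣)
open import Data.Fin.Subset.Properties using (_∈?_)
open import Data.Nat.Base using (ℕ; _+_; _*_; _≤_)
open import Data.Product.Base using (∃; ∃₂; _×_; _,_)
open import Data.Sum.Base using (_⊎_; inj₁; inj₂)
open import Data.Vec.Base using (_∷_; tabulate)
open import Function.Base using (_∘_)
open import Function.Bundles using (_↔_; _⇔_; Inverse)
open import Level using (0ℓ)
open import Relation.Binary.Construct.Closure.ReflexiveTransitive using (Star)
open import Relation.Binary.Core using (Rel)
open import Relation.Binary.Definitions using (Decidable; Symmetric)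
open import Relation.Binary.PropositionalEquality using (_≡_; _≢_; refl; sym)
open import Relation.Nullary.Decidable using (does; ¬?; _×-dec_; _⊎-dec_)
open import Relation.Nullary.Negation using (¬_)

record Graph (n : ℕ) : Set₁ where
  field
    Adj    : Rel (Fin n) 0ℓ
    Adj?   : Decidable Adj
    symm   : Symmetric Adj
    irrefl : ∀ u → ¬ Adj u u

open Graph public

Complete : ∀ n → Graph n
Complete n = record
  { Adj    = _≢_
  ; Adj?   = λ u v → ¬? (u ≟ v)
  ; symm   = λ u≢v v≡u → u≢v (sym v≡u)
  ; irrefl = λ u u≢u → u≢u refl
  }

K₂ : Graph 2
K₂ = Complete 2

infix 4 _≅_

_≅_ : ∀ {m n} → Graph m → Graph n → Set
_≅_ {m} {n} G H =
  ∃ λ (f : Fin m ↔ Fin n) → ∀ u v → Adj G u v ⇔ Adj H (Inverse.to f u) (Inverse.to f v)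

Connected : ∀ {n} → Graph n → Set
Connected G = ∀ u v → Star (Adj G) u v

Nontrivial : ∀ {n} → Graph n → Set
Nontrivial {n} _ = 2 ≤ n

□-Adj : ∀ {m n} → Graph m → Graph n → Rel (Fin m × Fin n) 0ℓ
□-Adj G H (u₁ , v₁) (u₂ , v₂) = (u₁ ≡ u₂ × Adj H v₁ v₂) ⊎ (v₁ ≡ v₂ × Adj G u₁ u₂)

infixl 7 _□_

-- A vertex x of the product stands for the pair  remQuot n x : Fin m × Fin n;
-- remQuot n is a bijection with inverse  combine.
_□_ : ∀ {m n} → Graph m → Graph n → Graph (m * n)
_□_ {m} {n} G H = record
  { Adj    = λ x y → □-Adj G H (remQuot n x) (remQuot n y)
  ; Adj?   = λ x y → dec (remQuot n x) (remQuot n y)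
  ; symm   = λ {x} {y} → symm′ (remQuot n x) (remQuot n y)
  ; irrefl = λ x → irrefl′ (remQuot n x)
  }
  where
  dec : Decidable (□-Adj G H)
  dec (u₁ , v₁) (u₂ , v₂) =
    ((u₁ ≟ u₂) ×-dec Adj? H v₁ v₂) ⊎-dec ((v₁ ≟ v₂) ×-dec Adj? G u₁ u₂)

  symm′ : ∀ p q → □-Adj G H p q → □-Adj G H q p
  symm′ _ _ (inj₁ (eq , e)) = inj₁ (sym eq , symm H e)
  symm′ _ _ (inj₂ (eq , e)) = inj₂ (sym eq , symm G e)

  irrefl′ : ∀ p → ¬ □-Adj G H p p
  irrefl′ (_ , v) (inj₁ (_ , e)) = irrefl H v e
  irrefl′ (u , _) (inj₂ (_ , e)) = irrefl G u e

-- The increasing enumeration of the elements of X.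
element : ∀ {n} (X : Subset n) → Fin ∣ X ∣ → Fin n
element (true  ∷ X) zero    = zero
element (true  ∷ X) (suc i) = suc (element X i)
element (false ∷ X) i       = suc (element X i)

infix 8 _[_]

-- The induced subgraph, its vertices renumbered along  element X.
_[_] : ∀ {n} → Graph n → (X : Subset n) → Graph ∣ X ∣
G [ X ] = record
  { Adj    = λ i j → Adj G (element X i) (element X j)
  ; Adj?   = λ i j → Adj? G (element X i) (element X j)
  ; symm   = symm G
  ; irrefl = irrefl G ∘ element X
  }

-- The union of the open neighbourhoods of the vertices in S.
N : ∀ {n} → Graph n → Subset n → Subset n
N G S = tabulate λ v → does (any? λ u → (u ∈? S) ×-dec Adj? G u v)

Dominating : ∀ {n} → Graph n → Subset n → Set
Dominating G S = S ∪ N G S ≡ ⊤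

TotalDominating : ∀ {n} → Graph n → Subset n → Set
TotalDominating G S = N G S ≡ ⊤

IsMinimum : ∀ {n} → (Subset n → Set) → Subset n → Set
IsMinimum P S = P S × (∀ T → P T → ∣ S ∣ ≤ ∣ T ∣)

-- Relations rather than functions: a graph with an isolated vertex has no total
-- dominating set, so γₜ is only partially defined.
infix 4 γ_≈_ γₜ_≈_

γ_≈_ : ∀ {n} → Graph n → ℕ → Set
γ G ≈ k = ∃ λ S → IsMinimum (Dominating G) S × ∣ S ∣ ≡ k

γₜ_≈_ : ∀ {n} → Graph n → ℕ → Set
γₜ G ≈ k = ∃ λ S → IsMinimum (TotalDominating G) S × ∣ S ∣ ≡ k

record Partition {n} (X A B : Subset n) : Set where
  field
    cover     : A ∪ B ≡ X
    disjoint  : A ∩ B ≡ ⊥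
    nonempty₁ : Nonempty A
    nonempty₂ : Nonempty B

𝓕₁ : ∀ {n} → Graph n → Set
𝓕₁ G = ∃ λ k → γ G ≈ k × γₜ G ≈ 2 * k

𝓕₂ : ∀ {n} → Graph n → Set
𝓕₂ G = ∃ λ D → IsMinimum (TotalDominating G) D
  × ∃₂ λ D₁ D₂ → Partition D D₁ D₂ × D₁ ≡ ∁ (N G D₂) × D₂ ≡ ∁ (N G D₁)

𝓕₃ : ∀ {n} → Graph n → Set
𝓕₃ G = ∃₂ λ V₁ V₂ → Partition ⊤ V₁ V₂ × 𝓕₁ (G [ V₁ ]) × 𝓕₂ (G [ V₂ ])
  × ∃₂ λ a b → γₜ G [ V₁ ] ≈ a × γₜ G [ V₂ ] ≈ b × γₜ G ≈ a + b

{-# OPTIONS --safe #-}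

-- Let D be a total dominating set of G □ H with fibres D_u, let P be the set of u with D_u ≠ ∅,
-- and call u isolated if it has no neighbour in P.  An isolated u has a total dominating fibre,
-- so |D_u| ≥ γₜ(H) = 2, and P together with one neighbour of each isolated vertex is a total
-- dominating set of G of size at most |D|.  Hence γₜ(G) ≤ γₜ(G □ H).
--
-- If equality holds, isolated vertices have fibres of size 2 and the other vertices of P fibres
-- of size 1.  Deleting one of the latter must destroy total domination, which forces them to
-- induce a perfect matching.  If H has at least three vertices, a vertex outside P sees enough
-- of P to allow an exchange producing a smaller set; so G is a single matched pair.  If H = K₂,
-- the isolated vertices dominate a part of G in 𝓕₁, and the matched vertices, coloured by their
-- fibres, witness 𝓕₂ on the remainder; if only one colour occurs, G itself is in 𝓕₁.
module Submission where

open import Defs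
open import Data.Bool.Base using (true; false)
open import Data.Fin.Base using (Fin; zero; suc; combine; remQuot; fromℕ<; _<_)
open import Data.Fin.Properties using (_≟_; _<?_; <-cmp; <-asym; any?; suc-injective; injective⇒≤; ¬∀⟶∃¬; remQuot-combine)
open import Data.Fin.Subset using (Subset; Nonempty; ⊤; ⊥; ∁; _∩_; _∪_; ∣_∣) renaming (_∈_ to _∈ˢ_)
open import Data.Fin.Subset.Properties using (⊆-antisym; ∈⊤; ∉⊥; x∈p∪q⁺; x∈p∪q⁻; x∈p∩q⁻; x∉p⇒x∈∁p; x∈∁p⇒x∉p; drop-there) renaming (_∈?_ to _∈ˢ?_)
open import Data.List.Base using (List; []; _∷_; _++_; length; map; filter; concat; tabulate)
open import Data.List.Membership.Propositional using (_∈_; _∉_)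
open import Data.List.Membership.Propositional.Properties using (∈-map⁺; ∈-++⁺ˡ; ∈-++⁺ʳ; ∈-concat⁺′; ∈-tabulate⁺; ∈-filter⁺)
open import Data.List.Membership.Setoid.Properties using (index-injective)
open import Data.List.Properties using (length-map; length-++; length-tabulate; tabulate-cong)
open import Data.List.Relation.Unary.Any using (here; there; index)
open import Data.Nat.Base as ℕ using (ℕ; zero; suc; _+_; _*_; _≤_; z≤n; s≤s)
open import Data.Nat.ListAction using (sum)
open import Data.Nat.Properties hiding (_≟_; _<?_; <-cmp; <-asym; suc-injective)
open import Data.Product.Base using (∃; ∃₂; _×_; _,_; proj₁; proj₂; uncurry; map₁)
open import Data.Sum.Base using (_⊎_; inj₁; inj₂)
open import Data.Vec.Base as Vec using (_∷_)
open import Data.Vec.Properties using ([]=⇒lookup; lookup⇒[]=; lookup∘tabulate)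
open import Function.Base using (_∘_; id)
open import Function.Bundles using (_⇔_; mk⇔; mk↔ₛ′; Inverse; Equivalence)
open import Function.Definitions using (Injective)
open import Relation.Binary.Construct.Closure.ReflexiveTransitive using (Star; ε; _◅_)
open import Relation.Binary.Definitions using (tri<; tri≈; tri>)
open import Relation.Binary.PropositionalEquality using (_≡_; _≢_; refl; sym; trans; cong; cong₂; subst; setoid)
open import Relation.Nullary.Decidable using (Dec; yes; no; does; dec-true; _×-dec_; _⊎-dec_; ¬?)
open import Relation.Nullary.Negation using (¬_; contradiction)
open import Relation.Unary using (Decidable)
import Data.List.Membership.DecPropositional as DecMembership

module _ {n : ℕ} where
  open DecMembership (_≟_ {n}) public using (_∈?_)

-- Subsets given by decidable predicates, and their cardinalities

⟨_⟩ : ∀ {n} {P : Fin n → Set} → Decidable P → Subset n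
⟨ P? ⟩ = Vec.tabulate (does ∘ P?)

∈⟨⟩⁺ : ∀ {n} {P : Fin n → Set} (P? : Decidable P) {v} → P v → v ∈ˢ ⟨ P? ⟩
∈⟨⟩⁺ P? {v} p = lookup⇒[]= v _ (trans (lookup∘tabulate (does ∘ P?) v) (dec-true (P? v) p))

∈⟨⟩⁻ : ∀ {n} {P : Fin n → Set} (P? : Decidable P) {v} → v ∈ˢ ⟨ P? ⟩ → P v
∈⟨⟩⁻ P? {v} v∈ with P? v | trans (sym (lookup∘tabulate (does ∘ P?) v)) ([]=⇒lookup v∈)
... | yes p | _ = p

∈N⁺ : ∀ {n} (G : Graph n) {S u v} → u ∈ˢ S → Adj G u v → v ∈ˢ N G S
∈N⁺ G {S} {u} u∈S e = ∈⟨⟩⁺ (λ v → any? λ u → (u ∈ˢ? S) ×-dec Adj? G u v) (u , u∈S , e)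

∈N⁻ : ∀ {n} (G : Graph n) {S v} → v ∈ˢ N G S → ∃ λ u → u ∈ˢ S × Adj G u v
∈N⁻ G {S} = ∈⟨⟩⁻ (λ v → any? λ u → (u ∈ˢ? S) ×-dec Adj? G u v)

≡⊤⁺ : ∀ {n} {S : Subset n} → (∀ v → v ∈ˢ S) → S ≡ ⊤
≡⊤⁺ all∈ = ⊆-antisym (λ _ → ∈⊤) (λ {v} _ → all∈ v)

≡⊤⁻ : ∀ {n} {S : Subset n} → S ≡ ⊤ → ∀ v → v ∈ˢ S
≡⊤⁻ S≡⊤ v = subst (v ∈ˢ_) (sym S≡⊤) ∈⊤

element-∈ : ∀ {n} (X : Subset n) i → element X i ∈ˢ X
element-∈ (true  ∷ X) zero    = Vec.here
element-∈ (true  ∷ X) (suc i) = Vec.there (element-∈ X i)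
element-∈ (false ∷ X) i       = Vec.there (element-∈ X i)

element-injective : ∀ {n} (X : Subset n) → Injective _≡_ _≡_ (element X)
element-injective (true  ∷ X) {zero}  {zero}  eq = refl
element-injective (true  ∷ X) {suc i} {suc j} eq = cong suc (element-injective X (suc-injective eq))
element-injective (false ∷ X)                 eq = element-injective X (suc-injective eq)

element-surjective : ∀ {n} (X : Subset n) {u} → u ∈ˢ X → ∃ λ i → element X i ≡ u
element-surjective (true  ∷ X) {zero}  u∈X = zero , refl
element-surjective (true  ∷ X) {suc u} u∈X with i , refl ← element-surjective X (drop-there u∈X) = suc i , refl
element-surjective (false ∷ X) {suc u} u∈X with i , refl ← element-surjective X (drop-there u∈X) = i , refl

toList : ∀ {n} → Subset n → List (Fin n)
toList S = tabulate (element S)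

∈-toList : ∀ {n} {S : Subset n} {u} → u ∈ˢ S → u ∈ toList S
∈-toList {S = S} u∈S with i , refl ← element-surjective S u∈S = ∈-tabulate⁺ i

length-toList : ∀ {n} (S : Subset n) → length (toList S) ≡ ∣ S ∣
length-toList S = length-tabulate (element S)

-- The positions of the values `f i` in `L` are pairwise distinct, so the pigeonhole principle
-- applies even if `L` has repetitions.
injection-≤ : ∀ {m n} {f : Fin m → Fin n} (L : List (Fin n)) →
  Injective _≡_ _≡_ f → (∀ i → f i ∈ L) → m ≤ length L
injection-≤ L f-inj f∈ = injective⇒≤ {f = λ i → index (f∈ i)}
  λ {i} {j} eq → f-inj (index-injective (setoid _) (f∈ i) (f∈ j) eq)

∣∣≤length : ∀ {m n} (S : Subset m) {f : Fin m → Fin n} (L : List (Fin n)) →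
  Injective _≡_ _≡_ f → (∀ {i} → i ∈ˢ S → f i ∈ L) → ∣ S ∣ ≤ length L
∣∣≤length S L f-inj f∈ = injection-≤ L (element-injective S ∘ f-inj) (f∈ ∘ element-∈ S)

opaque
  missing : ∀ {n} (L : List (Fin n)) → length L ℕ.< n → ∃ λ v → v ∉ L
  missing L L<n = ¬∀⟶∃¬ _ (_∈ L) (_∈? L) λ all∈ → <⇒≱ L<n (injection-≤ L id all∈)

disjoint-∣∪∣ : ∀ {n} (A B : Subset n) → A ∩ B ≡ ⊥ → ∣ A ∣ + ∣ B ∣ ≡ ∣ A ∪ B ∣
disjoint-∣∪∣ Vec.[]      Vec.[]      eq = refl
disjoint-∣∪∣ (true  ∷ A) (false ∷ B) eq = cong suc (disjoint-∣∪∣ A B (cong Vec.tail eq))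
disjoint-∣∪∣ (false ∷ A) (true  ∷ B) eq = trans (+-suc ∣ A ∣ ∣ B ∣) (cong suc (disjoint-∣∪∣ A B (cong Vec.tail eq)))
disjoint-∣∪∣ (false ∷ A) (false ∷ B) eq = disjoint-∣∪∣ A B (cong Vec.tail eq)

-- Finite sums and families of lists

Σ : ∀ {m} → (Fin m → ℕ) → ℕ
Σ f = sum (tabulate f)

Σ-mono : ∀ {m} {f g : Fin m → ℕ} → (∀ u → f u ≤ g u) → Σ f ≤ Σ g
Σ-mono {zero}  f≤g = z≤n
Σ-mono {suc m} f≤g = +-mono-≤ (f≤g zero) (Σ-mono (f≤g ∘ suc))

Σ-+ : ∀ {m} (f g : Fin m → ℕ) → Σ f + Σ g ≡ Σ (λ u → f u + g u)
Σ-+ {zero}  f g = refl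
Σ-+ {suc m} f g = trans (swap-middle (f zero) _ (g zero) _) (cong (f zero + g zero +_) (Σ-+ (f ∘ suc) (g ∘ suc)))
  where
  open import Algebra.Properties.CommutativeSemigroup +-commutativeSemigroup using () renaming (interchange to swap-middle)

-- A strict inequality at one index cannot be made up for at another. This turns equality of total
-- sizes into equality fibre by fibre.
Σ-tight : ∀ {m} {f g : Fin m → ℕ} → (∀ u → f u ≤ g u) → Σ g ≤ Σ f → ∀ u → g u ≤ f u
Σ-tight {f = f} {g} f≤g Σg≤Σf zero =
  +-cancelʳ-≤ (Σ (g ∘ suc)) (g zero) (f zero) (≤-trans Σg≤Σf (+-monoʳ-≤ (f zero) (Σ-mono (f≤g ∘ suc))))
Σ-tight {f = f} {g} f≤g Σg≤Σf (suc u) = Σ-tight (f≤g ∘ suc)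
  (+-cancelˡ-≤ (g zero) (Σ (g ∘ suc)) (Σ (f ∘ suc)) (≤-trans Σg≤Σf (+-monoˡ-≤ (Σ (f ∘ suc)) (f≤g zero)))) u

Σ-bump : ∀ {m} {f g : Fin m → ℕ} a → (∀ u → u ≢ a → g u ≤ f u) → g a ≤ suc (f a) → Σ g ≤ suc (Σ f)
Σ-bump zero g≤f ga≤ = +-mono-≤ ga≤ (Σ-mono λ u → g≤f (suc u) λ ())
Σ-bump {f = f} {g} (suc a) g≤f ga≤ =
  ≤-trans (+-mono-≤ (g≤f zero λ ()) (Σ-bump a (λ u u≢a → g≤f (suc u) (u≢a ∘ suc-injective)) ga≤))
    (≤-reflexive (+-suc (f zero) _))

gather : ∀ {m} {A : Set} → (Fin m → List A) → List A
gather t = concat (tabulate t)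

∈-gather : ∀ {m} {A : Set} (t : Fin m → List A) u {x} → x ∈ t u → x ∈ gather t
∈-gather t u x∈ = ∈-concat⁺′ x∈ (∈-tabulate⁺ {f = t} u)

length-gather : ∀ {m} {A : Set} (t : Fin m → List A) → length (gather t) ≡ Σ (length ∘ t)
length-gather {zero}  t = refl
length-gather {suc m} t = trans (length-++ (t zero)) (cong (length (t zero) +_) (length-gather (t ∘ suc)))

fibre : ∀ {m} {A : Set} → List (Fin m × A) → Fin m → List A
fibre L u = map proj₂ (filter (λ p → proj₁ p ≟ u) L)

∈-fibre : ∀ {m} {A : Set} {L : List (Fin m × A)} {u v} → (u , v) ∈ L → v ∈ fibre L u
∈-fibre uv∈L = ∈-map⁺ proj₂ (∈-filter⁺ _ uv∈L refl)

Σ-fibre : ∀ {m} {A : Set} (L : List (Fin m × A)) → Σ (length ∘ fibre L) ≤ length L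
Σ-fibre {m} [] = zeros m
  where
  zeros : ∀ m → Σ {m} (λ _ → 0) ≤ 0
  zeros zero    = z≤n
  zeros (suc m) = zeros m
Σ-fibre ((a , v) ∷ L) = ≤-trans (Σ-bump a other same) (s≤s (Σ-fibre L))
  where
  other : ∀ u → u ≢ a → length (fibre ((a , v) ∷ L) u) ≤ length (fibre L u)
  other u u≢a with a ≟ u
  ... | yes a≡u = contradiction (sym a≡u) u≢a
  ... | no _    = ≤-refl
  same : length (fibre ((a , v) ∷ L) a) ≤ suc (length (fibre L a))
  same with a ≟ a
  ... | yes _ = ≤-refl
  ... | no _  = n≤1+n _

-- Domination by lists of vertices

-- Lists may repeat vertices, since length bounds cardinality from above; unions become
-- concatenations without any disjointness to check.
TotDom : ∀ {n} → Graph n → List (Fin n) → Set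
TotDom G L = ∀ v → ∃ λ u → u ∈ L × Adj G u v

Dom : ∀ {n} → Graph n → List (Fin n) → Set
Dom G L = ∀ v → ∃ λ u → u ∈ L × (u ≡ v ⊎ Adj G u v)

_≤γₜ_ : ∀ {n} → ℕ → Graph n → Set
k ≤γₜ G = ∀ L → TotDom G L → k ≤ length L

_≤γ_ : ∀ {n} → ℕ → Graph n → Set
k ≤γ G = ∀ L → Dom G L → k ≤ length L

fromList : ∀ {n} → List (Fin n) → Subset n
fromList L = ⟨ _∈? L ⟩

∣fromList∣ : ∀ {n} (L : List (Fin n)) → ∣ fromList L ∣ ≤ length L
∣fromList∣ L = ∣∣≤length (fromList L) {f = id} L id (∈⟨⟩⁻ (_∈? L))

totDom-toList : ∀ {n} (G : Graph n) {S} → TotalDominating G S → TotDom G (toList S)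
totDom-toList G td v with u , u∈S , e ← ∈N⁻ G (≡⊤⁻ td v) = u , ∈-toList u∈S , e

totDom-fromList : ∀ {n} (G : Graph n) {L} → TotDom G L → TotalDominating G (fromList L)
totDom-fromList G {L} td = ≡⊤⁺ λ v → let u , u∈L , e = td v in ∈N⁺ G (∈⟨⟩⁺ (_∈? L) u∈L) e

dom-toList : ∀ {n} (G : Graph n) {S} → Dominating G S → Dom G (toList S)
dom-toList G {S} d v with x∈p∪q⁻ S (N G S) (≡⊤⁻ d v)
... | inj₁ v∈S = v , ∈-toList v∈S , inj₁ refl
... | inj₂ v∈N with u , u∈S , e ← ∈N⁻ G v∈N = u , ∈-toList u∈S , inj₂ e

dom-fromList : ∀ {n} (G : Graph n) {L} → Dom G L → Dominating G (fromList L)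
dom-fromList G {L} d = ≡⊤⁺ λ v → x∈p∪q⁺ (side v (d v))
  where
  side : ∀ v → (∃ λ u → u ∈ L × (u ≡ v ⊎ Adj G u v)) → v ∈ˢ fromList L ⊎ v ∈ˢ N G (fromList L)
  side v (u , u∈L , inj₁ refl) = inj₁ (∈⟨⟩⁺ (_∈? L) u∈L)
  side v (u , u∈L , inj₂ e)    = inj₂ (∈N⁺ G (∈⟨⟩⁺ (_∈? L) u∈L) e)

γₜ⁺ : ∀ {n k} (G : Graph n) {L} → k ≤γₜ G → TotDom G L → length L ≤ k → γₜ G ≈ k
γₜ⁺ {k = k} G {L} lb td len =
  fromList L , (totDom-fromList G td , λ T tdT → ≤-trans size (bound T tdT)) , ≤-antisym size (bound _ (totDom-fromList G td))
  where
  size : ∣ fromList L ∣ ≤ k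
  size = ≤-trans (∣fromList∣ L) len
  bound : ∀ T → TotalDominating G T → k ≤ ∣ T ∣
  bound T tdT = subst (k ≤_) (length-toList T) (lb _ (totDom-toList G tdT))

γ⁺ : ∀ {n k} (G : Graph n) {L} → k ≤γ G → Dom G L → length L ≤ k → γ G ≈ k
γ⁺ {k = k} G {L} lb d len =
  fromList L , (dom-fromList G d , λ T dT → ≤-trans size (bound T dT)) , ≤-antisym size (bound _ (dom-fromList G d))
  where
  size : ∣ fromList L ∣ ≤ k
  size = ≤-trans (∣fromList∣ L) len
  bound : ∀ T → Dominating G T → k ≤ ∣ T ∣
  bound T dT = subst (k ≤_) (length-toList T) (lb _ (dom-toList G dT))

minimum⇒≤γₜ : ∀ {n} (G : Graph n) {S} → IsMinimum (TotalDominating G) S → ∣ S ∣ ≤γₜ G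
minimum⇒≤γₜ G (_ , min) L td = ≤-trans (min _ (totDom-fromList G td)) (∣fromList∣ L)

γₜ⇒≤γₜ : ∀ {n k} (G : Graph n) → γₜ G ≈ k → k ≤γₜ G
γₜ⇒≤γₜ G (S , min , refl) = minimum⇒≤γₜ G min

γₜ⇒totDom : ∀ {n k} (G : Graph n) → γₜ G ≈ k → ∃ λ L → TotDom G L × length L ≡ k
γₜ⇒totDom G (S , (td , _) , refl) = toList S , totDom-toList G td , length-toList S

γ⇒dom : ∀ {n k} (G : Graph n) → γ G ≈ k → ∃ λ L → Dom G L × length L ≡ k
γ⇒dom G (S , (d , _) , refl) = toList S , dom-toList G d , length-toList S

-- Total domination from domination, and membership in `𝓕₁`

NoIsolated : ∀ {n} → Graph n → Set
NoIsolated G = ∀ u → ∃ λ v → Adj G u v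

connected⇒noIsolated : ∀ {n} (G : Graph n) → Nontrivial G → Connected G → NoIsolated G
connected⇒noIsolated {suc (suc n)} G (s≤s (s≤s z≤n)) conn = λ where
    zero    → first-step (λ ()) (conn zero (suc zero))
    (suc u) → first-step (λ ()) (conn (suc u) zero)
  where
  first-step : ∀ {u v} → u ≢ v → Star (Adj G) u v → ∃ λ w → Adj G u w
  first-step u≢u ε       = contradiction refl u≢u
  first-step _   (e ◅ _) = _ , e

-- This is the bound `γₜ ≤ 2γ`: the chosen neighbours take care of the vertices of `L` themselves.
totDom-double : ∀ {n} (G : Graph n) (nb : NoIsolated G) {L} → Dom G L → TotDom G (L ++ map (proj₁ ∘ nb) L)
totDom-double G nb {L} d v with d v
... | u , u∈L , inj₁ refl = proj₁ (nb u) , ∈-++⁺ʳ L (∈-map⁺ _ u∈L) , symm G (proj₂ (nb u))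
... | u , u∈L , inj₂ e    = u , ∈-++⁺ˡ u∈L , e

length-double : ∀ {A : Set} (f : A → A) (L : List A) → length (L ++ map f L) ≡ length L + length L
length-double f L = trans (length-++ L) (cong (length L +_) (length-map f L))

2≤γₜ : ∀ {n} (G : Graph n) → Fin n → 2 ≤γₜ G
2≤γₜ G v []            td with _ , () , _ ← td v
2≤γₜ G v (x ∷ [])      td with _ , here refl , e ← td x = contradiction e (irrefl G x)
2≤γₜ G v (_ ∷ _ ∷ _)   td = s≤s (s≤s z≤n)

m+m≤n+n⇒m≤n : ∀ {m n} → m + m ≤ n + n → m ≤ n
m+m≤n+n⇒m≤n le = ≮⇒≥ λ n<m → <⇒≱ (+-mono-< n<m n<m) le

-- Doubling a dominating list `A` gives `k ≤ 2|A|`, so `2|L| ≤ k` makes `L` minimum, and `L` doubled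
-- attains the lower bound `k`.
𝓕₁-half : ∀ {n k} (G : Graph n) (nb : NoIsolated G) {L} → k ≤γₜ G →
  Dom G L → length L + length L ≤ k → 𝓕₁ G
𝓕₁-half {k = k} G nb {L} lb d 2L≤k = length L ,
  γ⁺ G (λ A dA → m+m≤n+n⇒m≤n (≤-trans 2L≤k (k≤2A dA))) d ≤-refl ,
  γₜ⁺ G (λ A td → subst (_≤ length A) 2L (≤-trans 2L≤k (lb A td))) (totDom-double G nb d)
    (≤-reflexive (trans (length-double _ L) 2L))
  where
  k≤2A : ∀ {A} → Dom G A → k ≤ length A + length A
  k≤2A {A} dA = subst (k ≤_) (length-double _ A) (lb _ (totDom-double G nb dA))
  2L : length L + length L ≡ 2 * length L
  2L = cong (length L +_) (sym (+-identityʳ (length L)))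

-- Two dominating sets whose sizes sum to at most γₜ ≤ 2γ must both be minimum.
𝓕₁⁺ : ∀ {n k} (G : Graph n) (nb : NoIsolated G) {L L′} → k ≤γₜ G →
  Dom G L → Dom G L′ → length L + length L′ ≤ k → 𝓕₁ G
𝓕₁⁺ {k = k} G nb {L} {L′} lb d d′ sum≤k with ≤-total (length L) (length L′)
... | inj₁ L≤L′ = 𝓕₁-half G nb lb d (≤-trans (+-monoʳ-≤ (length L) L≤L′) sum≤k)
... | inj₂ L′≤L = 𝓕₁-half G nb lb d′ (≤-trans (+-monoˡ-≤ (length L′) L′≤L) sum≤k)

-- Graphs isomorphic to a single edge

≅K₂⁺ : ∀ {n} (G : Graph n) {a b} → Adj G a b → (∀ v → v ≡ a ⊎ v ≡ b) → G ≅ K₂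
≅K₂⁺ {n} G {a} {b} ab cases = mk↔ₛ′ to from to∘from from∘to , λ u v → mk⇔ (adj⇒≢ u v) (≢⇒adj u v)
  where
  a≢b : a ≢ b
  a≢b refl = irrefl G a ab
  to : Fin n → Fin 2
  to v with v ≟ a
  ... | yes _ = zero
  ... | no _  = suc zero
  from : Fin 2 → Fin n
  from zero    = a
  from (suc _) = b
  to-a : to a ≡ zero
  to-a with a ≟ a
  ... | yes _  = refl
  ... | no a≢a = contradiction refl a≢a
  to-b : to b ≡ suc zero
  to-b with b ≟ a
  ... | yes b≡a = contradiction (sym b≡a) a≢b
  ... | no _    = refl
  to∘from : ∀ i → to (from i) ≡ i
  to∘from zero       = to-a
  to∘from (suc zero) = to-b
  from∘to : ∀ v → from (to v) ≡ v
  from∘to v with v ≟ a | cases v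
  ... | yes v≡a | _        = sym v≡a
  ... | no v≢a  | inj₁ v≡a = contradiction v≡a v≢a
  ... | no _    | inj₂ v≡b = sym v≡b
  adj⇒≢ : ∀ u v → Adj G u v → to u ≢ to v
  adj⇒≢ u v e eq with refl ← trans (sym (from∘to u)) (trans (cong from eq) (from∘to v)) = irrefl G u e
  ≢⇒adj : ∀ u v → to u ≢ to v → Adj G u v
  ≢⇒adj u v u≢v with cases u | cases v
  ... | inj₁ refl | inj₁ refl = contradiction refl u≢v
  ... | inj₁ refl | inj₂ refl = ab
  ... | inj₂ refl | inj₁ refl = symm G ab
  ... | inj₂ refl | inj₂ refl = contradiction refl u≢v

≅K₂⁻ : ∀ {n} (G : Graph n) → G ≅ K₂ → ∃₂ λ a b → Adj G a b × (∀ v → v ≡ a ⊎ v ≡ b)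
≅K₂⁻ G (f , adj) = from zero , from (suc zero) ,
  Equivalence.from (adj _ _) (λ eq → 0≢1 (trans (sym (Inverse.strictlyInverseˡ f zero)) (trans eq (Inverse.strictlyInverseˡ f (suc zero))))) ,
  λ v → cases v (Inverse.to f v) refl
  where
  from = Inverse.from f
  0≢1 : _≢_ {A = Fin 2} zero (suc zero)
  0≢1 ()
  cases : ∀ v i → Inverse.to f v ≡ i → v ≡ from zero ⊎ v ≡ from (suc zero)
  cases v zero       eq = inj₁ (trans (sym (Inverse.strictlyInverseʳ f v)) (cong from eq))
  cases v (suc zero) eq = inj₂ (trans (sym (Inverse.strictlyInverseʳ f v)) (cong from eq))

-- Total domination of products through fibres

ProdDom : ∀ {m n} → Graph m → Graph n → List (Fin m × Fin n) → Set
ProdDom G H L = ∀ p → ∃ λ q → q ∈ L × □-Adj G H q p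

totDom⇒prodDom : ∀ {m n} (G : Graph m) (H : Graph n) {L} → TotDom (G □ H) L → ProdDom G H (map (remQuot n) L)
totDom⇒prodDom {n = n} G H td (u , v) with x , x∈L , e ← td (combine u v) =
  remQuot n x , ∈-map⁺ _ x∈L , subst (□-Adj G H (remQuot n x)) (remQuot-combine u v) e

prodDom⇒totDom : ∀ {m n} (G : Graph m) (H : Graph n) {L} → ProdDom G H L → TotDom (G □ H) (map (uncurry combine) L)
prodDom⇒totDom {n = n} G H pd x with (u , v) , uv∈L , e ← pd (remQuot n x) =
  combine u v , ∈-map⁺ _ uv∈L , subst (λ q → □-Adj G H q (remQuot n x)) (sym (remQuot-combine u v)) e

override : ∀ {m} {A : Set} → (Fin m → A) → Fin m → A → Fin m → A
override t a l u with u ≟ a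
... | yes _ = l
... | no _  = t u

override-same : ∀ {m} {A : Set} (t : Fin m → A) a {l} → override t a l a ≡ l
override-same t a with a ≟ a
... | yes _  = refl
... | no a≢a = contradiction refl a≢a

override-other : ∀ {m} {A : Set} (t : Fin m → A) {a l u} → u ≢ a → override t a l u ≡ t u
override-other t {a} {u = u} u≢a with u ≟ a
... | yes u≡a = contradiction u≡a u≢a
... | no _    = refl

override-elim : ∀ {m} {A : Set} (C : Fin m → A → Set) (t : Fin m → A) {a l} → C a l → (∀ u → C u (t u)) →
  ∀ u → C u (override t a l u)
override-elim C t {a} ca ct u with u ≟ a
... | yes refl = ca
... | no _     = ct u

module Fibres {m n : ℕ} (G : Graph m) (H : Graph n) (nb : NoIsolated G) (2≤γₜH : 2 ≤γₜ H)
  (L : List (Fin m × Fin n)) (pd : ProdDom G H L) where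

  d : Fin m → List (Fin n)
  d = fibre L

  opaque
    dominated : ∀ u v → (∃ λ v′ → v′ ∈ d u × Adj H v′ v) ⊎ (∃ λ u′ → v ∈ d u′ × Adj G u′ u)
    dominated u v with pd (u , v)
    ... | (u , v′) , q∈L , inj₁ (refl , e) = inj₁ (v′ , ∈-fibre q∈L , e)
    ... | (u′ , v) , q∈L , inj₂ (refl , e) = inj₂ (u′ , ∈-fibre q∈L , e)

  P : Fin m → Set
  P u = ∃ λ v → v ∈ d u

  P? : Decidable P
  P? u with d u
  ... | []    = no λ ()
  ... | v ∷ _ = yes (v , here refl)

  -- The isolated vertices are those with `¬ Q`.
  Q : Fin m → Set
  Q u = ∃ λ w → P w × Adj G w u

  Q? : Decidable Q
  Q? u = any? λ w → P? w ×-dec Adj? G w u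

  ¬Q⇒2≤ : ∀ {u} → ¬ Q u → 2 ≤ length (d u)
  ¬Q⇒2≤ {u} ¬q = 2≤γₜH (d u) totDom
    where
    totDom : TotDom H (d u)
    totDom v with dominated u v
    ... | inj₁ within           = within
    ... | inj₂ (u′ , v∈ , e)    = contradiction (u′ , (v , v∈) , e) ¬q

  P⇒nonempty : ∀ {u} → P u → 1 ≤ length (d u)
  P⇒nonempty {u} (v , v∈) with d u | v∈
  ... | _ ∷ _ | _ = s≤s z≤n

  -- No constructor records `P` for an isolated vertex: it follows from the fibre having at least
  -- two elements.
  data Kind (u : Fin m) : Set where
    outside  : ¬ P u → Q u → Kind u
    isolated : ¬ Q u → Kind u
    matched  : P u → Q u → Kind u

  kind : ∀ u → Kind u
  kind u with P? u | Q? u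
  ... | _     | no ¬q = isolated ¬q
  ... | yes p | yes q = matched p q
  ... | no ¬p | yes q = outside ¬p q

  -- The vertices of `G` charged to the fibre over `u`. No share is longer than its fibre, and all
  -- shares together total dominate `G`.
  share : ∀ {u} → Kind u → List (Fin m)
  share     (outside _ _) = []
  share {u} (isolated _)  = u ∷ proj₁ (nb u) ∷ []
  share {u} (matched _ _) = u ∷ []

  base : Fin m → List (Fin m)
  base u = share (kind u)

  -- Total domination by the concatenated shares, recording the owner `u` of each dominating vertex
  -- so that single shares can be altered.
  Covering : (Fin m → List (Fin m)) → Set
  Covering t = ∀ v → ∃₂ λ u w → w ∈ t u × Adj G w v

  covering⇒≤Σ : ∀ {k} → k ≤γₜ G → ∀ t → Covering t → k ≤ Σ (length ∘ t)
  covering⇒≤Σ {k} lb t cov = subst (k ≤_) (length-gather t)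
    (lb (gather t) λ v → let u , w , w∈ , e = cov v in w , ∈-gather t u w∈ , e)

  P⇒∈base : ∀ {u} → P u → u ∈ base u
  P⇒∈base {u} p with kind u
  ... | outside ¬p _ = contradiction p ¬p
  ... | isolated _   = here refl
  ... | matched _ _  = here refl

  ¬Q⇒nb∈base : ∀ {u} → ¬ Q u → proj₁ (nb u) ∈ base u
  ¬Q⇒nb∈base {u} ¬q with kind u
  ... | outside _ q = contradiction q ¬q
  ... | isolated _  = there (here refl)
  ... | matched _ q = contradiction q ¬q

  base-covering : Covering base
  base-covering v with Q? v
  ... | yes (w , p , e) = w , w , P⇒∈base p , e
  ... | no ¬q           = v , proj₁ (nb v) , ¬Q⇒nb∈base ¬q , symm G (proj₂ (nb v))

  base≤d : ∀ u → length (base u) ≤ length (d u)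
  base≤d u with kind u
  ... | outside _ _ = z≤n
  ... | isolated ¬q = ¬Q⇒2≤ ¬q
  ... | matched p _ = P⇒nonempty p

  ≤length : ∀ {k} → k ≤γₜ G → k ≤ length L
  ≤length lb = ≤-trans (covering⇒≤Σ lb base base-covering) (≤-trans (Σ-mono base≤d) (Σ-fibre L))

  -- The case of equality: structure of a tight total dominating set

  module Tight {k : ℕ} (lb : k ≤γₜ G) (len : length L ≤ k) (2≤n : 2 ≤ n) where

    -- The chain `k ≤ Σ|t u| ≤ Σ|d u| ≤ |L| ≤ k` collapses, so shares and fibres agree in length at
    -- every index.
    tight : ∀ t → Covering t → (∀ u → length (t u) ≤ length (d u)) → ∀ u → length (d u) ≤ length (t u)
    tight t cov t≤d = Σ-tight t≤d (≤-trans (Σ-fibre L) (≤-trans len (covering⇒≤Σ lb t cov)))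

    d≤base : ∀ u → length (d u) ≤ length (base u)
    d≤base = tight base base-covering base≤d

    length-isolated : ∀ {u} → ¬ Q u → length (d u) ≤ 2
    length-isolated {u} ¬q with kind u | d≤base u
    ... | outside _ q | _  = contradiction q ¬q
    ... | isolated _  | le = le
    ... | matched _ q | _  = contradiction q ¬q

    length-matched : ∀ {u} → Q u → length (d u) ≤ 1
    length-matched {u} q with kind u | d≤base u
    ... | outside _ _ | le = ≤-trans le z≤n
    ... | isolated ¬q | _  = contradiction q ¬q
    ... | matched _ _ | le = le

    matched-unique : ∀ {u} → Q u → ∀ {v w} → v ∈ d u → w ∈ d u → v ≡ w
    matched-unique {u} q v∈ w∈ with d u | length-matched q | v∈ | w∈
    ... | _ ∷ [] | _ | here refl | here refl = refl
    ... | _ ∷ _ ∷ _ | s≤s () | _ | _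

    -- Every exchange argument below ends here: shares that fit into the fibres, one of them
    -- strictly, would total dominate `G` with fewer than `k` vertices.
    shrink : ∀ {a l} → length l ℕ.< length (d a) → ∀ t → (∀ u → length (t u) ≤ length (d u)) →
      ¬ Covering (override t a l)
    shrink {a} {l} l<d t t≤d cov = <⇒≱ l<d (subst (λ l′ → length (d a) ≤ length l′) (override-same t a)
      (tight _ cov (override-elim (λ u l′ → length l′ ≤ length (d u)) t (<⇒≤ l<d) t≤d) a))

    opaque
      -- Some `v` is missing from `l`, and the empty fibre over `z` cannot dominate `(z , v)`.
      -- Taking `l` to be the fibre over some vertex forces `u` to differ from that vertex.
      outside-reaches : ∀ {z} → ¬ P z → ∀ l → length l ℕ.< n → ∃₂ λ u v → v ∈ d u × v ∉ l × Adj G u z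
      outside-reaches {z} ¬p l l<n with v , v∉l ← missing l l<n with dominated z v
      ... | inj₁ (v′ , v′∈ , _) = contradiction (v′ , v′∈) ¬p
      ... | inj₂ (u , v∈ , e)   = u , v , v∈ , v∉l , e

    OnlyNeighbour : Fin m → Fin m → Set
    OnlyNeighbour y x = ∀ {w} → P w → Adj G w x → w ≡ y

    opaque
      private-neighbour : ∀ {x} → P x → Q x → ∃ λ z → P z × Adj G x z × OnlyNeighbour x z
      private-neighbour {x} px qx = conclude (¬∀⟶∃¬ m Other Other? λ other → shrink (P⇒nonempty px) base base≤d (covers other))
        where
        -- `Other z` ensures that `z` keeps a dominator after the share of `x` is emptied; a vertex
        -- where it fails is the private neighbour.
        Other : Fin m → Set
        Other z = ¬ Q z ⊎ ∃ λ u → P u × u ≢ x × Adj G u z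
        Other? : Decidable Other
        Other? z = ¬? (Q? z) ⊎-dec any? λ u → P? u ×-dec (¬? (u ≟ x) ×-dec Adj? G u z)
        keep : ∀ {u w} → u ≢ x → w ∈ base u → w ∈ override base x [] u
        keep u≢x = subst (_ ∈_) (sym (override-other base u≢x))
        covers : (∀ z → Other z) → Covering (override base x [])
        covers other z with other z
        ... | inj₁ ¬q = z , proj₁ (nb z) , keep (λ { refl → ¬q qx }) (¬Q⇒nb∈base ¬q) , symm G (proj₂ (nb z))
        ... | inj₂ (u , p , u≢x , e) = u , u , keep u≢x (P⇒∈base p) , e
        conclude : (∃ λ z → ¬ Other z) → ∃ λ z → P z × Adj G x z × OnlyNeighbour x z
        conclude (z , ¬other) = z , pz , xz , only
          where
          only : OnlyNeighbour x z
          only {w} p e with w ≟ x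
          ... | yes w≡x = w≡x
          ... | no w≢x  = contradiction (inj₂ (w , p , w≢x , e)) ¬other
          qz : Q z
          qz with Q? z
          ... | yes q = q
          ... | no ¬q = contradiction (inj₁ ¬q) ¬other
          xz : Adj G x z
          xz = let w , p , e = qz in subst (λ y → Adj G y z) (only p e) e
          pz : P z
          pz with P? z
          ... | yes p = p
          -- The fibre over `x` has at most one element and `H` at least two vertices, so a `z`
          -- outside `P` would have a neighbour in `P` other than `x`.
          ... | no ¬p with u , v , v∈ , v∉ , e ← outside-reaches ¬p (d x) (≤-trans (s≤s (length-matched qx)) 2≤n) =
            contradiction (inj₂ (u , (v , v∈) , (λ { refl → v∉ v∈ }) , e)) ¬other

    -- A private neighbour z of x has only x as a neighbour in P, so the private neighbour of z is x.
    opaque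
      partner : ∀ {x} → P x → Q x → ∃ λ y → P y × Adj G x y × OnlyNeighbour x y × OnlyNeighbour y x
      partner {x} px qx with y , py , xy , only ← private-neighbour px qx
        with z , pz , yz , only′ ← private-neighbour py (x , px , xy)
        with refl ← only pz (symm G yz) = y , py , xy , only , only′

    override₂-kept : ∀ {a b la lb s w} → s ≢ a → s ≢ b → w ∈ base s → w ∈ override (override base a la) b lb s
    override₂-kept {a} {b} {la} s≢a s≢b = subst (_ ∈_)
      (sym (trans (override-other (override base a la) s≢b) (override-other base s≢a)))

    override₂-new : ∀ {a b la lb w} → a ≢ b → w ∈ la → w ∈ override (override base a la) b lb a
    override₂-new {a} {b} {la} a≢b = subst (_ ∈_)
      (sym (trans (override-other (override base a la) a≢b) (override-same base a)))

    override-base≤d : ∀ {a la} → length la ≤ length (d a) → ∀ u → length (override base a la u) ≤ length (d u)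
    override-base≤d la≤ = override-elim (λ u l → length l ≤ length (d u)) base la≤ base≤d

    opaque
      -- Charging `z` to `u` dominates both `u` and `u′`, so the share of `u′` can drop to `u′`
      -- alone, below its fibre size of at least two.
      no-common-neighbour : ∀ {u u′ z} → ¬ Q u → ¬ Q u′ → u ≢ u′ → Adj G u z → ¬ Adj G u′ z
      no-common-neighbour {u} {u′} {z} ¬q ¬q′ u≢u′ uz u′z =
        shrink (¬Q⇒2≤ ¬q′) (override base u (u ∷ z ∷ [])) (override-base≤d (¬Q⇒2≤ ¬q)) covers
        where
        t : Fin m → List (Fin m)
        t = override (override base u (u ∷ z ∷ [])) u′ (u′ ∷ [])
        P⇒∈t : ∀ {w} → P w → w ∈ t w
        P⇒∈t {w} p = by-cases (w ≟ u′) (w ≟ u)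
          where
          by-cases : Dec (w ≡ u′) → Dec (w ≡ u) → w ∈ t w
          by-cases (yes refl) _          = subst (w ∈_) (sym (override-same (override base u (u ∷ z ∷ [])) w)) (here refl)
          by-cases (no w≢u′)  (yes refl) = override₂-new w≢u′ (here refl)
          by-cases (no w≢u′)  (no w≢u)   = override₂-kept w≢u w≢u′ (P⇒∈base p)
        covers : Covering t
        covers w with Q? w | w ≟ u | w ≟ u′
        ... | yes (s , p , e) | _ | _ = s , s , P⇒∈t p , e
        ... | no _ | yes refl | _ = u , z , override₂-new u≢u′ (there (here refl)) , symm G uz
        ... | no _ | no _ | yes refl = u , z , override₂-new u≢u′ (there (here refl)) , symm G u′z
        ... | no ¬qw | no w≢u | no w≢u′ =
          w , proj₁ (nb w) , override₂-kept w≢u w≢u′ (¬Q⇒nb∈base ¬qw) , symm G (proj₂ (nb w))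

    opaque
      -- Charging `z` to `u` also dominates `u′`, so the partner `y` of `u′` loses its purpose and
      -- its share can be emptied.
      no-common-neighbour′ : ∀ {u u′ z} → ¬ Q u → P u′ → Q u′ → Adj G u z → ¬ Adj G u′ z
      no-common-neighbour′ {u} {u′} {z} ¬q p′ q′ uz u′z with y , py , u′y , only-y , only-u′ ← partner p′ q′ =
        shrink (P⇒nonempty py) (override base u (u ∷ z ∷ [])) (override-base≤d (¬Q⇒2≤ ¬q)) covers
        where
        t : Fin m → List (Fin m)
        t = override (override base u (u ∷ z ∷ [])) y []
        qy : Q y
        qy = u′ , p′ , u′y
        u≢y : u ≢ y
        u≢y refl = ¬q qy
        P⇒∈t : ∀ {w} → P w → w ≢ y → w ∈ t w
        P⇒∈t {w} p w≢y = by-cases (w ≟ u)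
          where
          by-cases : Dec (w ≡ u) → w ∈ t w
          by-cases (yes refl) = override₂-new w≢y (here refl)
          by-cases (no w≢u)   = override₂-kept w≢u w≢y (P⇒∈base p)
        covers : Covering t
        covers w with w ≟ u | w ≟ u′ | kind w
        ... | yes refl | _ | _ = u , z , override₂-new u≢y (there (here refl)) , symm G uz
        ... | no _ | yes refl | _ = u , z , override₂-new u≢y (there (here refl)) , symm G u′z
        ... | no w≢u | no _ | isolated ¬qw =
          w , proj₁ (nb w) , override₂-kept w≢u (λ { refl → ¬qw qy }) (¬Q⇒nb∈base ¬qw) , symm G (proj₂ (nb w))
        -- If `s` were `y`, then `w`, a neighbour of `y` in `P`, would be `u′`.
        ... | no _ | no w≢u′ | matched pw (s , ps , e) = s , s , P⇒∈t ps (λ { refl → w≢u′ (only-y pw (symm G e)) }) , e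
        -- The fibre over `y` is too small to be all of `H`, so an outside vertex has a neighbour in
        -- `P` other than `y`.
        ... | no _ | no _ | outside ¬pw _
          with s , r , r∈ , r∉ , e ← outside-reaches ¬pw (d y) (≤-trans (s≤s (length-matched qy)) 2≤n) =
          s , s , P⇒∈t (r , r∈) (λ { refl → r∉ r∈ }) , e

    -- A neighbour z of an isolated u sees a second vertex u′ of P, so charging z to u makes
    -- the neighbour charged to u′ (if u′ is isolated) or the partner of u′ superfluous.
    opaque
      all-Q : 3 ≤ n → ∀ u → Q u
      all-Q 3≤n u with Q? u
      ... | yes q = q
      ... | no ¬q with z , uz ← nb u
        -- The fibre over `u` has at most two elements, so `3 ≤ n` leaves a vertex of `H` that
        -- forces a second neighbour of `z` in `P`.
        with u′ , v , v∈ , v∉ , u′z ← outside-reaches (λ pz → ¬q (z , pz , symm G uz)) (d u) (≤-trans (s≤s (length-isolated ¬q)) 3≤n)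
        with Q? u′
      ... | no ¬q′ = contradiction u′z (no-common-neighbour ¬q ¬q′ (λ { refl → v∉ v∈ }) uz)
      ... | yes q′ = contradiction u′z (no-common-neighbour′ ¬q (v , v∈) q′ uz)

    pair<n : 3 ≤ n → ∀ a b → length (d a ++ d b) ℕ.< n
    pair<n 3≤n a b = ≤-trans (s≤s (≤-trans (≤-reflexive (length-++ (d a)))
      (+-mono-≤ (length-matched (all-Q 3≤n a)) (length-matched (all-Q 3≤n b))))) 3≤n

    -- A vertex z outside P sees two matched pairs, and can replace one vertex of each.
    opaque
      all-P : 3 ≤ n → ∀ z → P z
      all-P 3≤n z with P? z
      ... | yes p = p
      ... | no ¬pz with x , v , v∈ , _ , xz ← outside-reaches ¬pz [] (≤-trans (s≤s z≤n) 3≤n)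
        with y , py , xy , only-y , only-x ← partner (v , v∈) (all-Q 3≤n x)
        with x′ , v′ , v′∈ , v′∉ , x′z ← outside-reaches ¬pz (d x ++ d y) (pair<n 3≤n x y)
        with y′ , py′ , x′y′ , only-y′ , only-x′ ← partner (v′ , v′∈) (all-Q 3≤n x′) =
        -- As a neighbour of `x` and `x′`, the vertex `z` stands in for both partners: it fills the
        -- share of `y′`, and that of `y` is emptied.
        contradiction covers (shrink (P⇒nonempty py) (override base y′ (z ∷ [])) (override-base≤d (P⇒nonempty py′)))
        where
        y′≢y : y′ ≢ y
        y′≢y refl with refl ← only-y (v′ , v′∈) x′y′ = v′∉ (∈-++⁺ˡ v′∈)
        covers : Covering (override (override base y′ (z ∷ [])) y [])
        covers w with w ≟ x | w ≟ x′ | P? w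
        ... | yes refl | _ | _ = y′ , z , override₂-new y′≢y (here refl) , symm G xz
        ... | no _ | yes refl | _ = y′ , z , override₂-new y′≢y (here refl) , symm G x′z
        ... | no w≢x | no w≢x′ | yes pw with s , ps , e ← all-Q 3≤n w = s , s ,
          override₂-kept (λ { refl → w≢x′ (only-y′ pw (symm G e)) }) (λ { refl → w≢x (only-y pw (symm G e)) }) (P⇒∈base ps) , e
        -- The fibres over `y` and `y′` have at most two elements together, so `3 ≤ n` yields a
        -- neighbour in `P` different from both.
        ... | no _ | no _ | no ¬pw with s , r , r∈ , r∉ , e ← outside-reaches ¬pw (d y ++ d y′) (pair<n 3≤n y y′) = s , s ,
          override₂-kept (λ { refl → r∉ (∈-++⁺ʳ (d y) r∈) }) (λ { refl → r∉ (∈-++⁺ˡ r∈) }) (P⇒∈base (r , r∈)) , e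

    -- With every vertex in `P`, partners are each other's only neighbours in `G`, so connectedness
    -- leaves just `x` and `y`. Their one-element fibres coincide, and the common element dominates
    -- `H`.
    large : 3 ≤ n → Connected G → Fin m → G ≅ K₂ × γ H ≈ 1
    large 3≤n conn x with y , py , xy , only-y , only-x ← partner (all-P 3≤n x) (all-Q 3≤n x) =
      ≅K₂⁺ G xy (λ w → reach (inj₁ refl) (conn x w)) , center (all-P 3≤n x) py
      where
      reach : ∀ {u w} → u ≡ x ⊎ u ≡ y → Star (Adj G) u w → w ≡ x ⊎ w ≡ y
      reach u∈ ε = u∈
      reach (inj₁ refl) (e ◅ es) = reach (inj₂ (only-x (all-P 3≤n _) (symm G e))) es
      reach (inj₂ refl) (e ◅ es) = reach (inj₁ (only-y (all-P 3≤n _) (symm G e))) es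
      center : P x → P y → γ H ≈ 1
      center (v , v∈) (w , w∈y) = γ⁺ H 1≤γH dom ≤-refl
        where
        1≤γH : 1 ≤γ H
        1≤γH []      dm with _ , () , _ ← dm v
        1≤γH (_ ∷ _) dm = s≤s z≤n
        w≡v : w ≡ v
        -- The fibre over `x` is just `v` and cannot dominate `(x , v)`, so `v` lies in the fibre
        -- over `y`.
        w≡v with dominated x v
        ... | inj₁ (v′ , v′∈ , e) with refl ← matched-unique (all-Q 3≤n x) v∈ v′∈ = contradiction e (irrefl H v)
        ... | inj₂ (u , v∈u , e) with refl ← only-x (v , v∈u) e = matched-unique (all-Q 3≤n y) w∈y v∈u
        dom : Dom H (v ∷ [])
        dom r with dominated x r
        ... | inj₁ (v′ , v′∈ , e) with refl ← matched-unique (all-Q 3≤n x) v∈ v′∈ = v , here refl , inj₂ e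
        ... | inj₂ (u , r∈u , e) with refl ← only-x (r , r∈u) e =
          v , here refl , inj₁ (trans (sym w≡v) (matched-unique (all-Q 3≤n y) w∈y r∈u))

    -- The prism case: `H` is a single edge

    module TwoVertices (a b : Fin n) (ab : Adj H a b) (cases : ∀ v → v ≡ a ⊎ v ≡ b) where

      Opposite : Fin n → Fin n → Set
      Opposite i j = ∀ {v} → Adj H v i → v ≡ j

      opposite-ab : Opposite a b
      opposite-ab {v} e with cases v
      ... | inj₁ refl = contradiction e (irrefl H v)
      ... | inj₂ v≡b  = v≡b

      opposite-ba : Opposite b a
      opposite-ba {v} e with cases v
      ... | inj₁ v≡a  = v≡a
      ... | inj₂ refl = contradiction e (irrefl H v)

      a≢b : a ≢ b
      a≢b refl = irrefl H a ab

      -- The matched vertices of colour `i`; membership in the fibre supplies `P u`.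
      D : Fin n → Fin m → Set
      D i u = Q u × i ∈ d u

      D? : ∀ i → Decidable (D i)
      D? i u = Q? u ×-dec (i ∈? d u)

      -- The closed neighbourhood of the set of isolated vertices, which becomes the part in `𝓕₁`.
      V₁ : Fin m → Set
      V₁ u = ¬ Q u ⊎ ∃ λ w → ¬ Q w × Adj G w u

      V₁? : Decidable V₁
      V₁? u = ¬? (Q? u) ⊎-dec any? λ w → ¬? (Q? w) ×-dec Adj? G w u

      ¬V₁⇒Q : ∀ {u} → ¬ V₁ u → Q u
      ¬V₁⇒Q {u} ¬v₁ with Q? u
      ... | yes q = q
      ... | no ¬q = contradiction (inj₁ ¬q) ¬v₁

      D⇒¬V₁ : ∀ {i u} → D i u → ¬ V₁ u
      D⇒¬V₁ (q , _)          (inj₁ ¬q)            = ¬q q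
      D⇒¬V₁ {i} {u} (q , i∈) (inj₂ (w , ¬qw , e)) = ¬qw (u , (i , i∈) , symm G e)

      -- What dominates `(u , i)` is either `(u , j)` or some `(w , i)`, where `w` is not isolated
      -- because `u` lies outside `V₁`.
      ¬V₁⇒D : ∀ {i j u} → Opposite i j → ¬ V₁ u → D j u ⊎ ∃ λ w → D i w × Adj G w u
      ¬V₁⇒D {i} {u = u} opp ¬v₁ with dominated u i
      ... | inj₁ (v , v∈ , e) with refl ← opp e = inj₁ (¬V₁⇒Q ¬v₁ , v∈)
      ... | inj₂ (w , i∈ , e) with Q? w
      ...   | yes q = inj₂ (w , (q , i∈) , e)
      ...   | no ¬q = contradiction (inj₂ (w , ¬q , e)) ¬v₁

      -- The one-element fibre over `u` cannot dominate `(u , i)`, so a neighbouring fibre contains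
      -- `i`.
      D-same : ∀ {i u} → D i u → ∃ λ w → D i w × Adj G w u
      D-same {i} {u} (q , i∈) with dominated u i
      ... | inj₁ (v , v∈ , e) with refl ← matched-unique q v∈ i∈ = contradiction e (irrefl H i)
      ... | inj₂ (w , i∈w , e) = w , ((u , (i , i∈) , symm G e) , i∈w) , e

      -- Both `w` and the neighbour of colour `i` given by `D-same` are the partner of `u`, whose
      -- one-element fibre then contains `i` and `j`.
      D-cross : ∀ {i j u w} → D i u → D j w → Adj G w u → i ≡ j
      D-cross {i} {j} di@(q , i∈) (qw , j∈) e
        with w′ , (_ , i∈w′) , e′ ← D-same di | y , _ , _ , _ , only ← partner (i , i∈) q
        with refl ← only (j , j∈) e | refl ← only (i , i∈w′) e′ = matched-unique qw i∈w′ j∈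

      isolatedShare : ∀ {u} → Kind u → List (Fin m)
      isolatedShare {u} (isolated _) = u ∷ []
      isolatedShare     _            = []

      matchedShare : ∀ {u} → Kind u → List (Fin m)
      matchedShare {u} (matched _ _) = u ∷ []
      matchedShare     _             = []

      Us Ms : List (Fin m)
      Us = gather λ u → isolatedShare (kind u)
      Ms = gather λ u → matchedShare (kind u)

      nbUs : List (Fin m)
      nbUs = map (proj₁ ∘ nb) Us

      ¬Q⇒∈Us : ∀ {u} → ¬ Q u → u ∈ Us
      ¬Q⇒∈Us {u} ¬q = ∈-gather (λ u → isolatedShare (kind u)) u (∈share (kind u))
        where
        ∈share : (κ : Kind u) → u ∈ isolatedShare κ
        ∈share (outside _ q) = contradiction q ¬q
        ∈share (isolated _)  = here refl
        ∈share (matched _ q) = contradiction q ¬q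

      PQ⇒∈Ms : ∀ {u} → P u → Q u → u ∈ Ms
      PQ⇒∈Ms {u} p q = ∈-gather (λ u → matchedShare (kind u)) u (∈share (kind u))
        where
        ∈share : (κ : Kind u) → u ∈ matchedShare κ
        ∈share (outside ¬p _) = contradiction p ¬p
        ∈share (isolated ¬q)  = contradiction q ¬q
        ∈share (matched _ _)  = here refl

      gather₂≤k : ∀ (s t : Fin m → List (Fin m)) → (∀ u → length (s u) + length (t u) ≤ length (d u)) →
        length (gather s) + length (gather t) ≤ k
      gather₂≤k s t s+t≤d = ≤-trans
        (≤-reflexive (trans (cong₂ _+_ (length-gather s) (length-gather t)) (Σ-+ (length ∘ s) (length ∘ t))))
        (≤-trans (Σ-mono s+t≤d) (≤-trans (Σ-fibre L) len))

      A B : ℕ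
      A = length Us
      B = length Ms

      -- Fibres over isolated vertices have at least two elements, and fibres over matched vertices
      -- at least one.
      A+A+B≤k : (A + A) + B ≤ k
      A+A+B≤k = ≤-trans (≤-reflexive (cong (_+ B) 2A)) (gather₂≤k s (λ u → matchedShare (kind u)) (λ u → bound (kind u)))
        where
        s t : Fin m → List (Fin m)
        t u = isolatedShare (kind u)
        s u = isolatedShare (kind u) ++ isolatedShare (kind u)
        2A : A + A ≡ length (gather s)
        2A = trans (cong₂ _+_ (length-gather t) (length-gather t)) (trans (Σ-+ (length ∘ t) (length ∘ t))
          (trans (cong sum (tabulate-cong λ u → sym (length-++ (isolatedShare (kind u))))) (sym (length-gather s))))
        bound : ∀ {u} (κ : Kind u) → length (isolatedShare κ ++ isolatedShare κ) + length (matchedShare κ) ≤ length (d u)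
        bound (outside _ _) = z≤n
        bound (isolated ¬q) = ¬Q⇒2≤ ¬q
        bound (matched p _) = P⇒nonempty p

      -- When all matched fibres agree, one endpoint of each matched pair suffices: the two
      -- orientations of the pairs give two dominating sets of total size at most k.
      module OneColour (i : Fin n) (noDᵢ : ∀ u → ¬ D i u) where

        -- `R` orients the matched pairs and the head of each is kept. The order `_<_` and its
        -- converse keep opposite endpoints, while both keep the isolated vertices.
        halfShare : (R : Fin m → Fin m → Set) → (∀ v w → Dec (R v w)) → ∀ {u} → Kind u → List (Fin m)
        halfShare R R? {u} (outside _ _) = []
        halfShare R R? {u} (isolated _)  = u ∷ []
        halfShare R R? {u} (matched _ _) with any? (λ w → P? w ×-dec (Adj? G w u ×-dec R? w u))
        ... | yes _ = u ∷ []
        ... | no _  = []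

        half : (R : Fin m → Fin m → Set) → (∀ v w → Dec (R v w)) → Fin m → List (Fin m)
        half R R? u = halfShare R R? (kind u)

        half-dom : (R : Fin m → Fin m → Set) (R? : ∀ v w → Dec (R v w)) → (∀ {v w} → v ≢ w → R v w ⊎ R w v) →
          Dom G (gather (half R R?))
        half-dom R R? total v = dominator (kind v)
          where
          isolated∈ : ∀ {u} → ¬ Q u → u ∈ gather (half R R?)
          isolated∈ {u} ¬q = ∈-gather (half R R?) u (∈share (kind u))
            where
            ∈share : (κ : Kind u) → u ∈ halfShare R R? κ
            ∈share (outside _ q) = contradiction q ¬q
            ∈share (isolated _)  = here refl
            ∈share (matched _ q) = contradiction q ¬q
          matched∈ : ∀ {u w} → P u → P w → Adj G w u → R w u → u ∈ gather (half R R?)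
          matched∈ {u} {w} pu pw e r = ∈-gather (half R R?) u (∈share (kind u))
            where
            ∈share : (κ : Kind u) → u ∈ halfShare R R? κ
            ∈share (outside ¬p _) = contradiction pu ¬p
            ∈share (isolated _)   = here refl
            ∈share (matched _ _) with any? (λ w → P? w ×-dec (Adj? G w u ×-dec R? w u))
            ... | yes _ = here refl
            ... | no ¬∃ = contradiction (w , pw , e , r) ¬∃
          dominator : Kind v → ∃ λ u → u ∈ gather (half R R?) × (u ≡ v ⊎ Adj G u v)
          dominator (isolated ¬q) = v , isolated∈ ¬q , inj₁ refl
          dominator (matched p (w , pw , e)) with total {w} {v} (λ { refl → irrefl G v e })
          ... | inj₁ r = v , matched∈ p pw e r , inj₁ refl
          ... | inj₂ r = w , matched∈ pw p (symm G e) r , inj₂ e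
          -- A neighbouring fibre contains `i`; no matched fibre does, so it lies over an isolated
          -- vertex.
          dominator (outside ¬p _) with dominated v i
          ... | inj₁ (v′ , v′∈ , _) = contradiction (v′ , v′∈) ¬p
          ... | inj₂ (w , i∈ , e) with Q? w
          ...   | yes q = contradiction (q , i∈) (noDᵢ w)
          ...   | no ¬q = w , isolated∈ ¬q , inj₂ e

        𝓕₁G : 𝓕₁ G
        𝓕₁G = 𝓕₁⁺ G nb lb
          (half-dom _<_ _<?_ λ v≢w → compare v≢w)
          (half-dom (λ v w → w < v) (λ v w → w <? v) λ v≢w → compare (v≢w ∘ sym))
          (gather₂≤k (half _<_ _<?_) (half (λ v w → w < v) (λ v w → w <? v)) λ u → bound (kind u))
          where
          compare : ∀ {v w : Fin m} → v ≢ w → v < w ⊎ w < v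
          compare {v} {w} v≢w with <-cmp v w
          ... | tri< v<w _ _ = inj₁ v<w
          ... | tri≈ _ v≡w _ = contradiction v≡w v≢w
          ... | tri> _ _ w<v = inj₂ w<v
          bound : ∀ {u} (κ : Kind u) →
            length (halfShare _<_ _<?_ κ) + length (halfShare (λ v w → w < v) (λ v w → w <? v) κ) ≤ length (d u)
          bound (outside _ _) = z≤n
          bound (isolated ¬q) = ¬Q⇒2≤ ¬q
          bound {u} (matched p q)
            with any? (λ w → P? w ×-dec (Adj? G w u ×-dec (w <? u))) | any? (λ w → P? w ×-dec (Adj? G w u ×-dec (u <? w)))
          ... | yes _ | no _  = P⇒nonempty p
          ... | no _  | yes _ = P⇒nonempty p
          ... | no _  | no _  = z≤n
          -- Both `w` and `w′` are the partner of `u`, so the two orientations cannot both keep `u`.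
          ... | yes (w , pw , e , w<u) | yes (w′ , pw′ , e′ , u<w′)
            with _ , _ , _ , _ , only ← partner p q
            with refl ← only pw e | refl ← only pw′ e′ = contradiction w<u (<-asym u<w′)

      -- `K` is a copy of the subgraph outside `V₁`. The embedding is abstract so that `G` itself,
      -- when `V₁` is empty, and `G [ X₂ ]` are treated alike.
      module Remainder {l : ℕ} (K : Graph l) (e : Fin l → Fin m) (e-injective : Injective _≡_ _≡_ e)
        (adj⁺ : ∀ {x y} → Adj G (e x) (e y) → Adj K x y) (adj⁻ : ∀ {x y} → Adj K x y → Adj G (e x) (e y))
        (image⁻ : ∀ x → ¬ V₁ (e x)) (image⁺ : ∀ {u} → ¬ V₁ u → ∃ λ x → e x ≡ u) where

        C : Fin n → Subset l
        C i = ⟨ (λ x → D? i (e x)) ⟩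

        ∈C⁺ : ∀ i {x} → D i (e x) → x ∈ˢ C i
        ∈C⁺ i = ∈⟨⟩⁺ (λ x → D? i (e x))

        ∈C⁻ : ∀ i {x} → x ∈ˢ C i → D i (e x)
        ∈C⁻ i = ∈⟨⟩⁻ (λ x → D? i (e x))

        D⇒∈N : ∀ {i x w} → D i w → Adj G w (e x) → x ∈ˢ N K (C i)
        D⇒∈N {i} dw adj with y , refl ← image⁺ (D⇒¬V₁ dw) = ∈N⁺ K (∈C⁺ i dw) (adj⁺ adj)

        -- Adjacent matched vertices share a colour, so `C i` avoids the neighbourhood of `C j`; a
        -- vertex not dominated by colour `j` must have colour `i`.
        complement : ∀ i j → Opposite j i → i ≢ j → C i ≡ ∁ (N K (C j))
        complement i j opp i≢j = ⊆-antisym ⊆ ⊇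
          where
          ⊆ : ∀ {x} → x ∈ˢ C i → x ∈ˢ ∁ (N K (C j))
          ⊆ x∈ = x∉p⇒x∈∁p λ x∈N → let y , y∈ , adj = ∈N⁻ K x∈N in i≢j (D-cross (∈C⁻ i x∈) (∈C⁻ j y∈) (adj⁻ adj))
          ⊇ : ∀ {x} → x ∈ˢ ∁ (N K (C j)) → x ∈ˢ C i
          ⊇ {x} x∈ with ¬V₁⇒D opp (image⁻ x)
          ... | inj₁ dx             = ∈C⁺ i dx
          ... | inj₂ (w , dw , adj) = contradiction (D⇒∈N dw adj) (x∈∁p⇒x∉p x∈)

        totDom-C : TotalDominating K (C a ∪ C b)
        totDom-C = ≡⊤⁺ λ x → neighbour x (¬V₁⇒D opposite-ab (image⁻ x))
          where
          mono : ∀ {i x} → (∀ {y} → y ∈ˢ C i → y ∈ˢ C a ∪ C b) → x ∈ˢ N K (C i) → x ∈ˢ N K (C a ∪ C b)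
          mono ⊆ x∈ with y , y∈ , adj ← ∈N⁻ K x∈ = ∈N⁺ K (⊆ y∈) adj
          neighbour : ∀ x → D b (e x) ⊎ (∃ λ w → D a w × Adj G w (e x)) → x ∈ˢ N K (C a ∪ C b)
          neighbour x (inj₁ dx) with w , dw , adj ← D-same dx = mono (x∈p∪q⁺ ∘ inj₂) (D⇒∈N dw adj)
          neighbour x (inj₂ (w , dw , adj)) = mono (x∈p∪q⁺ ∘ inj₁) (D⇒∈N dw adj)

        size-C : ∣ C a ∪ C b ∣ ≤ B
        size-C = ∣∣≤length (C a ∪ C b) Ms e-injective λ x∈ → member (x∈p∪q⁻ (C a) (C b) x∈)
          where
          ∈Ms : ∀ {i u} → D i u → u ∈ Ms
          ∈Ms {i} (q , i∈) = PQ⇒∈Ms (i , i∈) q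
          member : ∀ {x} → x ∈ˢ C a ⊎ x ∈ˢ C b → e x ∈ Ms
          member (inj₁ x∈) = ∈Ms (∈C⁻ a x∈)
          member (inj₂ x∈) = ∈Ms (∈C⁻ b x∈)

        -- The isolated vertices and their chosen neighbours extend `T` to a total dominating list
        -- of `G`; cancel in `2A + B ≤ k ≤ 2A + |T|`.
        B≤γₜK : B ≤γₜ K
        B≤γₜK T td = +-cancelˡ-≤ (A + A) B (length T) (≤-trans A+A+B≤k (≤-trans (lb (Us ++ nbUs ++ map e T) totDom) (≤-reflexive size)))
          where
          size : length (Us ++ nbUs ++ map e T) ≡ (A + A) + length T
          size = trans (length-++ Us) (trans (cong (A +_) (trans (length-++ nbUs) (cong₂ _+_ (length-map _ Us) (length-map e T)))) (sym (+-assoc A A _)))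
          totDom : TotDom G (Us ++ nbUs ++ map e T)
          totDom v with V₁? v
          ... | yes (inj₁ ¬q) = proj₁ (nb v) , ∈-++⁺ʳ Us (∈-++⁺ˡ (∈-map⁺ _ (¬Q⇒∈Us ¬q))) , symm G (proj₂ (nb v))
          ... | yes (inj₂ (w , ¬q , adj)) = w , ∈-++⁺ˡ (¬Q⇒∈Us ¬q) , adj
          ... | no ¬v₁ with x , refl ← image⁺ ¬v₁ with y , y∈ , adj ← td x =
            e y , ∈-++⁺ʳ Us (∈-++⁺ʳ nbUs (∈-map⁺ e y∈)) , adj⁻ adj

        B≤ : ∀ T → TotalDominating K T → B ≤ ∣ T ∣
        B≤ T td = subst (B ≤_) (length-toList T) (B≤γₜK (toList T) (totDom-toList K td))

        minimum-C : IsMinimum (TotalDominating K) (C a ∪ C b)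
        minimum-C = totDom-C , λ T td → ≤-trans size-C (B≤ T td)

        γₜK : γₜ K ≈ B
        γₜK = C a ∪ C b , minimum-C , ≤-antisym size-C (B≤ _ totDom-C)

        𝓕₂K : ∃ (D a) → ∃ (D b) → 𝓕₂ K
        𝓕₂K (u , du) (w , dw) = C a ∪ C b , minimum-C , C a , C b , partition ,
          complement a b opposite-ba a≢b , complement b a opposite-ab (a≢b ∘ sym)
          where
          inhabited : ∀ {i u} → D i u → Nonempty (C i)
          inhabited {i} du with x , refl ← image⁺ (D⇒¬V₁ du) = x , ∈C⁺ i du
          partition : Partition (C a ∪ C b) (C a) (C b)
          partition = record
            { cover     = refl
            ; disjoint  = ⊆-antisym (λ x∈ → let x∈a , x∈b = x∈p∩q⁻ (C a) (C b) x∈ in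
                contradiction (matched-unique (proj₁ (∈C⁻ a x∈a)) (proj₂ (∈C⁻ a x∈a)) (proj₂ (∈C⁻ b x∈b))) a≢b)
                (λ x∈ → contradiction x∈ ∉⊥)
            ; nonempty₁ = inhabited du
            ; nonempty₂ = inhabited dw
            }

      module TwoParts (u₀ : Fin m) (¬q₀ : ¬ Q u₀) (exDa : ∃ (D a)) (exDb : ∃ (D b)) where

        X₁ X₂ : Subset m
        X₁ = ⟨ V₁? ⟩
        X₂ = ⟨ (λ u → ¬? (V₁? u)) ⟩

        partition : Partition ⊤ X₁ X₂
        partition = record
          { cover     = ≡⊤⁺ λ u → x∈p∪q⁺ (side u)
          ; disjoint  = ⊆-antisym (λ x∈ → let x∈₁ , x∈₂ = x∈p∩q⁻ X₁ X₂ x∈ in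
              contradiction (∈⟨⟩⁻ V₁? x∈₁) (∈⟨⟩⁻ (λ u → ¬? (V₁? u)) x∈₂)) (λ x∈ → contradiction x∈ ∉⊥)
          ; nonempty₁ = u₀ , ∈⟨⟩⁺ V₁? (inj₁ ¬q₀)
          ; nonempty₂ = proj₁ exDa , ∈⟨⟩⁺ (λ u → ¬? (V₁? u)) (D⇒¬V₁ (proj₂ exDa))
          }
          where
          side : ∀ u → u ∈ˢ X₁ ⊎ u ∈ˢ X₂
          side u with V₁? u
          ... | yes v₁ = inj₁ (∈⟨⟩⁺ V₁? v₁)
          ... | no ¬v₁ = inj₂ (∈⟨⟩⁺ (λ u → ¬? (V₁? u)) ¬v₁)

        open Remainder (G [ X₂ ]) (element X₂) (element-injective X₂) id id
          (λ x → ∈⟨⟩⁻ (λ u → ¬? (V₁? u)) (element-∈ X₂ x))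
          (λ ¬v₁ → element-surjective X₂ (∈⟨⟩⁺ (λ u → ¬? (V₁? u)) ¬v₁))

        e₁ : Fin ∣ X₁ ∣ → Fin m
        e₁ = element X₁

        image₁⁺ : ∀ {u} → V₁ u → ∃ λ x → e₁ x ≡ u
        image₁⁺ v₁ = element-surjective X₁ (∈⟨⟩⁺ V₁? v₁)

        image₁⁻ : ∀ x → V₁ (e₁ x)
        image₁⁻ x = ∈⟨⟩⁻ V₁? (element-∈ X₁ x)

        noIsolated₁ : NoIsolated (G [ X₁ ])
        noIsolated₁ x with image₁⁻ x
        ... | inj₁ ¬q with y , eq ← image₁⁺ (inj₂ (e₁ x , ¬q , proj₂ (nb (e₁ x)))) =
          y , subst (Adj G (e₁ x)) (sym eq) (proj₂ (nb (e₁ x)))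
        ... | inj₂ (w , ¬q , adj) with y , refl ← image₁⁺ (inj₁ ¬q) = y , symm G adj

        U₁ : Subset ∣ X₁ ∣
        U₁ = ⟨ (λ x → ¬? (Q? (e₁ x))) ⟩

        dom₁ : Dom (G [ X₁ ]) (toList U₁)
        dom₁ x with image₁⁻ x
        ... | inj₁ ¬q = x , ∈-toList (∈⟨⟩⁺ (λ x → ¬? (Q? (e₁ x))) ¬q) , inj₁ refl
        ... | inj₂ (w , ¬q , adj) with y , refl ← image₁⁺ (inj₁ ¬q) =
          y , ∈-toList (∈⟨⟩⁺ (λ x → ¬? (Q? (e₁ x))) ¬q) , inj₂ adj

        2U₁≤ : length (toList U₁) + length (toList U₁) ≤ A + A
        2U₁≤ = +-mono-≤ U₁≤A U₁≤A
          where
          U₁≤A : length (toList U₁) ≤ A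
          U₁≤A = subst (_≤ A) (sym (length-toList U₁))
            (∣∣≤length U₁ Us (element-injective X₁) λ x∈ → ¬Q⇒∈Us (∈⟨⟩⁻ (λ x → ¬? (Q? (e₁ x))) x∈))

        -- The matched vertices extend `T` to a total dominating list of `G`; cancel in
        -- `2A + B ≤ k ≤ |T| + B`.
        2A≤γₜ : (A + A) ≤γₜ (G [ X₁ ])
        2A≤γₜ T td = +-cancelʳ-≤ B (A + A) (length T) (≤-trans A+A+B≤k (≤-trans (lb (map e₁ T ++ Ms) totDom)
          (≤-reflexive (trans (length-++ (map e₁ T)) (cong (_+ B) (length-map e₁ T))))))
          where
          matched∈ : ∀ {i v} → (∃ λ w → D i w × Adj G w v) → ∃ λ w → w ∈ map e₁ T ++ Ms × Adj G w v
          matched∈ {i} (w , (q , i∈) , adj) = w , ∈-++⁺ʳ (map e₁ T) (PQ⇒∈Ms (i , i∈) q) , adj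
          totDom : TotDom G (map e₁ T ++ Ms)
          totDom v with V₁? v
          ... | yes v₁ with x , refl ← image₁⁺ v₁ with y , y∈ , adj ← td x = e₁ y , ∈-++⁺ˡ (∈-map⁺ e₁ y∈) , adj
          totDom v | no ¬v₁ with ¬V₁⇒D opposite-ab ¬v₁
          ... | inj₁ dv = matched∈ (D-same dv)
          ... | inj₂ dw = matched∈ dw

        -- The isolated vertices, their chosen neighbours and the matched vertices total dominate
        -- `G`, and `2A + B` is at most the lower bound `k`.
        γₜG : γₜ G ≈ (A + A) + B
        γₜG = γₜ⁺ G (λ T td → ≤-trans A+A+B≤k (lb T td)) totDom (≤-reflexive size)
          where
          size : length (Us ++ nbUs ++ Ms) ≡ (A + A) + B
          size = trans (length-++ Us) (trans (cong (A +_) (trans (length-++ nbUs) (cong (_+ B) (length-map _ Us)))) (sym (+-assoc A A B)))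
          totDom : TotDom G (Us ++ nbUs ++ Ms)
          totDom v with Q? v
          ... | no ¬q = proj₁ (nb v) , ∈-++⁺ʳ Us (∈-++⁺ˡ (∈-map⁺ _ (¬Q⇒∈Us ¬q))) , symm G (proj₂ (nb v))
          ... | yes (w , p , adj) with Q? w
          ...   | no ¬q = w , ∈-++⁺ˡ (¬Q⇒∈Us ¬q) , adj
          ...   | yes q = w , ∈-++⁺ʳ Us (∈-++⁺ʳ nbUs (PQ⇒∈Ms p q)) , adj

        𝓕₃G : 𝓕₃ G
        𝓕₃G = X₁ , X₂ , partition , 𝓕₁-half (G [ X₁ ]) noIsolated₁ 2A≤γₜ dom₁ 2U₁≤ , 𝓕₂K exDa exDb ,
          A + A , B , γₜ⁺ (G [ X₁ ]) 2A≤γₜ (totDom-double (G [ X₁ ]) noIsolated₁ dom₁)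
            (≤-trans (≤-reflexive (length-double _ (toList U₁))) 2U₁≤) , γₜK , γₜG

      small : 𝓕₁ G ⊎ 𝓕₂ G ⊎ 𝓕₃ G
      small with any? (D? a) | any? (D? b) | any? (λ u → ¬? (Q? u))
      ... | no ¬∃  | _       | _             = inj₁ (OneColour.𝓕₁G a λ u du → ¬∃ (u , du))
      ... | yes _  | no ¬∃   | _             = inj₁ (OneColour.𝓕₁G b λ u du → ¬∃ (u , du))
      ... | yes da | yes db  | yes (u , ¬q)  = inj₂ (inj₂ (TwoParts.𝓕₃G u ¬q da db))
      -- Without isolated vertices `V₁` is empty, so the remainder is `G` under the identity
      -- embedding.
      ... | yes da | yes db  | no ¬∃         = inj₂ (inj₁ (Remainder.𝓕₂K G id id id id
        ¬V₁ (λ {u} _ → u , refl) da db))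
        where
        ¬V₁ : ∀ u → ¬ V₁ u
        ¬V₁ u (inj₁ ¬q)           = ¬∃ (u , ¬q)
        ¬V₁ u (inj₂ (w , ¬q , _)) = ¬∃ (w , ¬q)

-- Total dominating sets of prisms

module Prism {n : ℕ} (H : Graph n) (a b : Fin n) (ab : Adj H a b) (cases : ∀ v → v ≡ a ⊎ v ≡ b) where

  -- An upper bound on the total domination number of `K □ H`, kept as a list of pairs so that lists
  -- for the parts of a graph can be joined.
  Coverable : ∀ {l} → Graph l → ℕ → Set
  Coverable K c = ∃ λ L → ProdDom K H L × length L ≤ c

  layers : ∀ {l} → List (Fin l) → List (Fin l) → List (Fin l × Fin n)
  layers S T = map (_, a) S ++ map (_, b) T

  length-layers : ∀ {l} (S T : List (Fin l)) → length (layers S T) ≡ length S + length T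
  length-layers S T = trans (length-++ (map (_, a) S)) (cong₂ _+_ (length-map _ S) (length-map _ T))

  ∈layer-a : ∀ {l} {S T : List (Fin l)} {u} → u ∈ S → (u , a) ∈ layers S T
  ∈layer-a u∈S = ∈-++⁺ˡ (∈-map⁺ _ u∈S)

  ∈layer-b : ∀ {l} (S : List (Fin l)) {T u} → u ∈ T → (u , b) ∈ layers S T
  ∈layer-b S u∈T = ∈-++⁺ʳ (map (_, a) S) (∈-map⁺ _ u∈T)

  -- The vertex `(u , a)` is dominated by `(u , b)` if `u ∈ T`, and otherwise from a neighbour of
  -- `u` in `S`; the other layer is symmetric.
  layers-prodDom : ∀ {l} (K : Graph l) {S T} →
    (∀ u → u ∈ T ⊎ ∃ λ w → w ∈ S × Adj K w u) → (∀ u → u ∈ S ⊎ ∃ λ w → w ∈ T × Adj K w u) →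
    ProdDom K H (layers S T)
  layers-prodDom K {S} {T} dom-a dom-b (u , v) with cases v
  ... | inj₁ refl with dom-a u
  ...   | inj₁ u∈T            = (u , b) , ∈layer-b S u∈T , inj₁ (refl , symm H ab)
  ...   | inj₂ (w , w∈S , e)  = (w , a) , ∈layer-a w∈S , inj₂ (refl , e)
  layers-prodDom K {S} {T} dom-a dom-b (u , v) | inj₂ refl with dom-b u
  ...   | inj₁ u∈S            = (u , a) , ∈layer-a u∈S , inj₁ (refl , ab)
  ...   | inj₂ (w , w∈T , e)  = (w , b) , ∈layer-b S w∈T , inj₂ (refl , e)

  -- A minimum dominating set placed in both layers has total size `2γ = γₜ`.
  𝓕₁⇒coverable : ∀ {l c} (K : Graph l) → 𝓕₁ K → γₜ K ≈ c → Coverable K c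
  𝓕₁⇒coverable {c = c} K (k , γk , γₜ2k) γₜc with S , dom , refl ← γ⇒dom K γk | T , td , refl ← γₜ⇒totDom K γₜc =
    layers S S , layers-prodDom K side side ,
    ≤-trans (≤-reflexive (trans (length-layers S S) (cong (length S +_) (sym (+-identityʳ (length S)))))) (γₜ⇒≤γₜ K γₜ2k T td)
    where
    side : ∀ u → u ∈ S ⊎ ∃ λ w → w ∈ S × Adj K w u
    side u with dom u
    ... | w , w∈S , inj₁ refl = inj₁ w∈S
    ... | w , w∈S , inj₂ e    = inj₂ (w , w∈S , e)

  -- `D₁` goes into layer `a` and `D₂` into layer `b`. What one part leaves undominated in its layer
  -- is exactly the other part, reached along the edge `ab`.
  𝓕₂⇒coverable : ∀ {l c} (K : Graph l) → 𝓕₂ K → γₜ K ≈ c → Coverable K c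
  𝓕₂⇒coverable {c = c} K (D , min , D₁ , D₂ , part , D₁≡ , D₂≡) γₜc with T , td , refl ← γₜ⇒totDom K γₜc =
    layers (toList D₁) (toList D₂) , layers-prodDom K (side D₂≡) (side D₁≡) ,
    ≤-trans (≤-reflexive size) (minimum⇒≤γₜ K min T td)
    where
    size : length (layers (toList D₁) (toList D₂)) ≡ ∣ D ∣
    size = trans (length-layers (toList D₁) (toList D₂)) (trans (cong₂ _+_ (length-toList D₁) (length-toList D₂))
      (trans (disjoint-∣∪∣ D₁ D₂ (Partition.disjoint part)) (cong ∣_∣ (Partition.cover part))))
    side : ∀ {A B} → B ≡ ∁ (N K A) → ∀ u → u ∈ toList B ⊎ ∃ λ w → w ∈ toList A × Adj K w u
    side {A} refl u with u ∈ˢ? N K A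
    ... | yes u∈N = let w , w∈A , e = ∈N⁻ K u∈N in inj₂ (w , ∈-toList w∈A , e)
    ... | no u∉N  = inj₁ (∈-toList (x∉p⇒x∈∁p u∉N))

  induced-dominated : ∀ {m} (G : Graph m) (X : Subset m) {L} → ProdDom (G [ X ]) H L → ∀ {u} → u ∈ˢ X → ∀ v →
    ∃ λ q → q ∈ map (map₁ (element X)) L × □-Adj G H q (u , v)
  induced-dominated G X pd u∈X v with x , refl ← element-surjective X u∈X with pd (x , v)
  ... | q , q∈L , inj₁ (refl , e) = map₁ (element X) q , ∈-map⁺ _ q∈L , inj₁ (refl , e)
  ... | q , q∈L , inj₂ (eq , e)   = map₁ (element X) q , ∈-map⁺ _ q∈L , inj₂ (eq , e)

  -- The products over the two parts embed in `G □ H`, so their lists join, and additivity of `γₜ`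
  -- over the parts gives the size.
  𝓕₃⇒coverable : ∀ {m c} (G : Graph m) → 𝓕₃ G → γₜ G ≈ c → Coverable G c
  𝓕₃⇒coverable {c = c} G (X₁ , X₂ , part , f₁ , f₂ , k₁ , k₂ , γₜ₁ , γₜ₂ , γₜG) γₜc
    with T , td , refl ← γₜ⇒totDom G γₜc
    with L₁ , pd₁ , len₁ ← 𝓕₁⇒coverable (G [ X₁ ]) f₁ γₜ₁ | L₂ , pd₂ , len₂ ← 𝓕₂⇒coverable (G [ X₂ ]) f₂ γₜ₂ =
    map (map₁ (element X₁)) L₁ ++ map (map₁ (element X₂)) L₂ , pd ,
    ≤-trans (≤-reflexive (trans (length-++ (map (map₁ (element X₁)) L₁)) (cong₂ _+_ (length-map _ L₁) (length-map _ L₂))))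
      (≤-trans (+-mono-≤ len₁ len₂) (γₜ⇒≤γₜ G γₜG T td))
    where
    pd : ProdDom G H (map (map₁ (element X₁)) L₁ ++ map (map₁ (element X₂)) L₂)
    pd (u , v) with x∈p∪q⁻ X₁ X₂ (≡⊤⁻ (Partition.cover part) u)
    ... | inj₁ u∈ = let q , q∈ , e = induced-dominated G X₁ pd₁ u∈ v in q , ∈-++⁺ˡ q∈ , e
    ... | inj₂ u∈ = let q , q∈ , e = induced-dominated G X₂ pd₂ u∈ v in q , ∈-++⁺ʳ (map (map₁ (element X₁)) L₁) q∈ , e

  𝓕⇒coverable : ∀ {m} (G : Graph m) → 𝓕₁ G ⊎ 𝓕₂ G ⊎ 𝓕₃ G → ∃ λ k → γₜ G ≈ k × Coverable G k
  𝓕⇒coverable G (inj₁ f@(k , _ , γₜG)) = 2 * k , γₜG , 𝓕₁⇒coverable G f γₜG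
  𝓕⇒coverable G (inj₂ (inj₁ f@(D , min , _))) = ∣ D ∣ , (D , min , refl) , 𝓕₂⇒coverable G f (D , min , refl)
  𝓕⇒coverable G (inj₂ (inj₂ f@(_ , _ , _ , _ , _ , k₁ , k₂ , _ , _ , γₜG))) = k₁ + k₂ , γₜG , 𝓕₃⇒coverable G f γₜG

-- The two implications

two-vertices : ∀ {n} (H : Graph n) → Nontrivial H → Connected H → n ≡ 2 →
  ∃₂ λ a b → Adj H a b × (∀ v → v ≡ a ⊎ v ≡ b)
two-vertices H ntH connH refl with connected⇒noIsolated H ntH connH zero
... | zero     , e = contradiction e (irrefl H zero)
... | suc zero , e = zero , suc zero , e , λ { zero → inj₁ refl ; (suc zero) → inj₂ refl }

forward : ∀ {m n} (G : Graph m) (H : Graph n) →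
  Nontrivial G → Connected G → Nontrivial H → Connected H → γₜ H ≈ 2 →
  (∃ λ k → γₜ G ≈ k × γₜ (G □ H) ≈ k) → (G ≅ K₂ × γ H ≈ 1) ⊎ (H ≅ K₂ × (𝓕₁ G ⊎ 𝓕₂ G ⊎ 𝓕₃ G))
forward {m} {n} G H ntG connG ntH connH γₜH (k , γₜG , γₜGH) with T , td , len ← γₜ⇒totDom (G □ H) γₜGH =
  by-size (m≤n⇒m<n∨m≡n ntH)
  where
  open Fibres G H (connected⇒noIsolated G ntG connG) (γₜ⇒≤γₜ H γₜH) (map (remQuot n) T) (totDom⇒prodDom G H td)
  open Tight (γₜ⇒≤γₜ G γₜG) (≤-reflexive (trans (length-map (remQuot {m} n) T) len)) ntH
  by-size : 2 ℕ.< n ⊎ 2 ≡ n → (G ≅ K₂ × γ H ≈ 1) ⊎ (H ≅ K₂ × (𝓕₁ G ⊎ 𝓕₂ G ⊎ 𝓕₃ G))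
  by-size (inj₁ 3≤n) = inj₁ (large 3≤n connG (fromℕ< ntG))
  by-size (inj₂ 2≡n) with a , b , ab , cases ← two-vertices H ntH connH (sym 2≡n) =
    inj₂ (≅K₂⁺ H ab cases , TwoVertices.small a b ab cases)

backward : ∀ {m n} (G : Graph m) (H : Graph n) →
  Nontrivial G → Connected G → γₜ H ≈ 2 →
  (G ≅ K₂ × γ H ≈ 1) ⊎ (H ≅ K₂ × (𝓕₁ G ⊎ 𝓕₂ G ⊎ 𝓕₃ G)) → ∃ λ k → γₜ G ≈ k × γₜ (G □ H) ≈ k
backward {m} {n} G H ntG connG γₜH = λ where
    (inj₁ (G≅K₂ , γH)) → 2 , star G≅K₂ γH
    (inj₂ (H≅K₂ , f))  → prism H≅K₂ f
  where
  nb : NoIsolated G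
  nb = connected⇒noIsolated G ntG connG
  product-γₜ : ∀ {k} → k ≤γₜ G → ∀ L → ProdDom G H L → length L ≤ k → γₜ (G □ H) ≈ k
  product-γₜ {k} lb L pd len = γₜ⁺ (G □ H)
    (λ T td → subst (k ≤_) (length-map (remQuot {m} n) T)
      (Fibres.≤length G H nb (γₜ⇒≤γₜ H γₜH) (map (remQuot n) T) (totDom⇒prodDom G H td) lb))
    (prodDom⇒totDom G H pd) (≤-trans (≤-reflexive (length-map _ L)) len)
  prism : H ≅ K₂ → 𝓕₁ G ⊎ 𝓕₂ G ⊎ 𝓕₃ G → ∃ λ k → γₜ G ≈ k × γₜ (G □ H) ≈ k
  prism H≅K₂ f with a , b , ab , cases ← ≅K₂⁻ H H≅K₂ with k , γₜG , L , pd , len ← Prism.𝓕⇒coverable H a b ab cases G f =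
    k , γₜG , product-γₜ (γₜ⇒≤γₜ G γₜG) L pd len
  -- If `v` dominates `H`, its copies over `a` and `b` dominate each other and the rest of both
  -- copies of `H`.
  star : G ≅ K₂ → γ H ≈ 1 → γₜ G ≈ 2 × γₜ (G □ H) ≈ 2
  star G≅K₂ γH with a , b , ab , cases ← ≅K₂⁻ G G≅K₂ | v ∷ [] , dom , refl ← γ⇒dom H γH =
    γₜ⁺ G 2≤ totDom ≤-refl , product-γₜ 2≤ ((a , v) ∷ (b , v) ∷ []) pd ≤-refl
    where
    2≤ : 2 ≤γₜ G
    2≤ = 2≤γₜ G a
    totDom : TotDom G (a ∷ b ∷ [])
    totDom u with cases u
    ... | inj₁ refl = b , there (here refl) , symm G ab
    ... | inj₂ refl = a , here refl , ab
    pd : ProdDom G H ((a , v) ∷ (b , v) ∷ [])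
    pd (u , w) with cases u | dom w
    ... | inj₁ refl | _ , here refl , inj₁ refl = (b , v) , there (here refl) , inj₂ (refl , symm G ab)
    ... | inj₂ refl | _ , here refl , inj₁ refl = (a , v) , here refl , inj₂ (refl , ab)
    ... | inj₁ refl | _ , here refl , inj₂ e    = (a , v) , here refl , inj₁ (refl , e)
    ... | inj₂ refl | _ , here refl , inj₂ e    = (b , v) , there (here refl) , inj₁ (refl , e)

theorem4 : ∀ {m n : ℕ} (G : Graph m) (H : Graph n) →
    Nontrivial G → Connected G → Nontrivial H → Connected H →
    γₜ H ≈ 2 →
    (∃ λ k → γₜ G ≈ k × γₜ (G □ H) ≈ k)
    ⇔ ((G ≅ K₂ × γ H ≈ 1) ⊎ (H ≅ K₂ × (𝓕₁ G ⊎ 𝓕₂ G ⊎ 𝓕₃ G)))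
theorem4 G H ntG connG ntH connH γₜH = mk⇔ (forward G H ntG connG ntH connH γₜH) (backward G H ntG connG γₜH)
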